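{- Let $r\ge 4$ be an integer. Then (a) $F_v(2_r;r-1)\ge r+7$; (b) $F_v(2_r;r-1)=r+7$ if $r\ge 6$; (c) $F_v(2_5;4)\le 16$.
   Context: All graphs are finite, undirected, without loops or multiple edges. For a graph $G$, $\omega(G)$ denotes the clique number (the largest $p$ such that $G$ contains $p$ pairwise adjacent vertices). For positive integers $a_1,\dots,a_r$, the notation $G\to^v(a_1,\dots,a_r)$ means that for every partition $V(G)=V_1\cup\dots\cup V_r$ into pairwise disjoint (possibly empty) sets there is an $i$ such that $V_i$ contains an $a_i$-clique. Write $(2_r)$ for the $r$-tuple $(2,\dots,2)$; thus $G\to^v(2_r)$ is equivalent to $\chi(G)\ge r+1$. For an integer $q$, $H_v(2_r;q)$ is the set of graphs $G$ with $G\to^v(2_r)$ and $\omega(G)<q$, and $F_v(2_r;q)=\min\{|V(G)|: G\in H_v(2_r;q)\}$ (the vertex Folkman number; it exists whenever $q\ge 3$). -}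

module Defs where

open import Data.Nat using (ℕ; _≤_; _<_)
open import Data.Fin using (Fin)
open import Data.Bool using (Bool; true; false)
open import Data.Product using (Σ; ∃; _×_)
open import Relation.Binary.PropositionalEquality using (_≡_; _≢_)
open import Relation.Nullary using (¬_)

record Graph (n : ℕ) : Set where
  field
    adj   : Fin n → Fin n → Bool
    sym   : ∀ x y → adj x y ≡ adj y x
    loopless : ∀ x → adj x x ≡ false

open Graph public

Adj : ∀ {n} → Graph n → Fin n → Fin n → Set
Adj G x y = adj G x y ≡ true

-- A p-clique in G: p pairwise adjacent vertices, given by a map Fin p → V(G)
-- (pairwise adjacency of distinct indices forces injectivity, since G is loopless).
IsClique : ∀ {n} → Graph n → (p : ℕ) → (Fin p → Fin n) → Set
IsClique G p f = ∀ i j → i ≢ j → Adj G (f i) (f j)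

HasClique : ∀ {n} → Graph n → ℕ → Set
HasClique {n} G p = Σ (Fin p → Fin n) λ f → IsClique G p f

CliqueNumberBelow : ∀ {n} → Graph n → ℕ → Set
CliqueNumberBelow G q = ¬ HasClique G q

-- G →v (a₁,…,aᵣ): every partition V(G) = V₁ ∪ … ∪ Vᵣ (given as a map
-- c : V(G) → Fin r, V_i = c⁻¹(i)) has some V_i containing an a_i-clique.
VArrows : ∀ {n} → Graph n → (r : ℕ) → (Fin r → ℕ) → Set
VArrows {n} G r a =
  (c : Fin n → Fin r) →
  ∃ λ i → Σ (Fin (a i) → Fin n) λ f → IsClique G (a i) f × (∀ k → c (f k) ≡ i)

twos : (r : ℕ) → Fin r → ℕ
twos r _ = 2

InHv : ∀ {n} → Graph n → (r q : ℕ) → Set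
InHv G r q = VArrows G r (twos r) × CliqueNumberBelow G q

IsFv : (r q m : ℕ) → Set
IsFv r q m =
  (Σ (Graph m) λ G → InHv G r q) ×
  (∀ n → n < m → (G : Graph n) → ¬ InHv G r q)

-- Let H be the complement of G. An induction on j ≤ 3 shows that a graph on fewer than k + 3j
-- vertices has a (k + 1)-clique or splits into fewer than k + j independent sets; j = 3 and
-- k = r ∸ 2 give the lower bound r + 7. A triangle of H is an independent set that lowers j by
-- one, so let H be triangle-free, with a matching ps and the set U of unmatched vertices. The
-- matched pairs and the singletons of U form a partition; if it is too large and ps cannot be
-- augmented, then U is a clique of G and each matched pair contains a vertex b complete to U
-- in G. For s = |ps| ∸ (j ∸ 1) ≤ 3 it remains to extend U to a clique with |U| + s vertices,
-- where |ps| ≥ 2s ∸ 1. The only delicate case is s = 3 with five pairs: if the partner of some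
-- b is complete to U as well, R(3,3) ≤ 6 applies; otherwise H contains a path on four of the b,
-- and, as no path of H augments ps, the partners of these four are joined in H to one and the
-- same vertex u of U only, so that they form a clique of G together with U ∖ {u}.
--
-- For the upper bounds, a colour class has more than a vertices if n > r a, which beats the
-- independence number a in the Ramsey graphs for R(3,5) and R(4,4); cones supply larger r.

module Submission where

open import Defs
open import Data.Bool using (Bool; true; false; not; _∧_; T; T?)
open import Data.Bool.ListAction using (all; any)
open import Data.Bool.Properties using (∧-zeroʳ)
open import Data.Empty using (⊥-elim)
open import Data.Fin using (Fin; zero; suc; toℕ; inject≤; punchIn; punchOut) renaming (_≟_ to _≟ᶠ_)
open import Data.Fin.Properties
  using (any?; suc-injective; inject≤-injective; punchIn-injective; punchInᵢ≢i; punchIn-punchOut)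
open import Data.List
  using (List; []; _∷_; _++_; [_]; map; concat; length; lookup; filterᵇ; allFin)
open import Data.List.Properties
  using (length-map; length-++; length-tabulate; ++-identityʳ; concat-map-[_])
open import Data.List.Membership.Propositional using (_∈_)
open import Data.List.Membership.Propositional.Properties
  using (∈-lookup; ∈-allFin; ∈-filter⁺; ∈-concat⁻)
open import Data.List.Relation.Binary.Permutation.Propositional
  using (_↭_; ↭-refl; ↭-sym; ↭-trans; ↭-prep; ↭-swap; ↭⇒↭ₛ)
open import Data.List.Relation.Binary.Permutation.Propositional.Properties
  using (All-resp-↭; Any-resp-↭; ∈-resp-↭; ↭-length; ++-commutativeMonoid; map⁺; ++-comm;
         ++⁺; ++⁺ˡ; ++⁺ʳ; shift; shifts)
open import Data.List.Relation.Binary.Permutation.Setoid.Properties using (AllPairs-resp-↭)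
open import Data.List.Relation.Binary.Subset.Propositional using (_⊆_)
open import Data.List.Relation.Unary.All as All using (All; []; _∷_)
open import Data.List.Relation.Unary.All.Properties using (All¬⇒¬Any; all⁺; ++⁻ˡ; ++⁻ʳ)
  renaming (map⁺ to All-map⁺)
open import Data.List.Relation.Unary.AllPairs as AllPairs using (AllPairs; []; _∷_)
import Data.List.Relation.Unary.AllPairs.Properties as AllPairsₚ
open import Data.List.Relation.Unary.Any using (Any; here; there; index)
open import Data.List.Relation.Unary.Any.Properties using (lookup-index)
open import Data.List.Relation.Unary.Unique.Propositional.Properties using (allFin⁺)
open import Data.Nat
  using (ℕ; zero; suc; _+_; _*_; _∸_; _≤_; _<_; z≤n; s≤s; _≤?_; _<?_; _≡ᵇ_; ∣_-_∣)
open import Data.Nat.Properties hiding (suc-injective)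
open import Data.Nat.Tactic.RingSolver using (solve-∀)
open import Data.Product using (∃; ∃₂; _×_; _,_; proj₁; proj₂; uncurry)
open import Data.Sum as Sum using (_⊎_; inj₁; inj₂)
open import Data.Unit using (tt)
open import Function using (_∘_; _on_; id; case_of_)
open import Function.Bundles using (mk⇔)
open import Level using (0ℓ)
open import Relation.Binary using (Rel; Symmetric)
open import Relation.Binary.PropositionalEquality as ≡ using (_≡_; _≢_; refl; cong; subst)
open import Relation.Nullary using (¬_; yes; no; does)
open import Relation.Nullary.Decidable using (dec-true; dec-false; does-⇔; toSum)

-- Searching lists up to permutation, and small Ramsey arguments.

module _ {X : Set} where

  open import Algebra.Solver.CommutativeMonoid (++-commutativeMonoid {A = X})

  extract : {P : X → Set} {xs : List X} → Any P xs → ∃₂ λ x r → P x × xs ↭ x ∷ r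
  extract (here px) = _ , _ , px , ↭-refl
  extract (there {x = y} i) with extract i
  ... | x , r , px , σ = x , y ∷ r , px , ↭-trans (↭-prep y σ) (↭-swap y x ↭-refl)

  -- What is found is moved to the front by a permutation: the later arguments treat lists as
  -- multisets, and the count of the remainder stays exact.
  search : {P Q : X → Set} → (∀ x → P x ⊎ Q x) → ∀ xs →
           (∃₂ λ x r → P x × xs ↭ x ∷ r) ⊎ All Q xs
  search P⊎Q xs with All.decide (Sum.swap ∘ P⊎Q) xs
  ... | inj₁ qs = inj₂ qs
  ... | inj₂ i  = inj₁ (extract i)

  searchPairs : {P Q : Rel X 0ℓ} → (∀ x y → P x y ⊎ Q x y) → ∀ xs →
                (∃₂ λ x y → ∃ λ r → P x y × xs ↭ x ∷ y ∷ r) ⊎ AllPairs Q xs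
  searchPairs P⊎Q []       = inj₂ []
  searchPairs P⊎Q (x ∷ xs) with search (P⊎Q x) xs | searchPairs P⊎Q xs
  ... | inj₁ (y , r , p , σ) | _ = inj₁ (x , y , r , p , ↭-prep x σ)
  ... | inj₂ _  | inj₁ (y , z , r , p , σ) = inj₁ (y , z , x ∷ r , p ,
        ↭-trans (↭-prep x σ) (↭-trans (↭-swap x y ↭-refl) (↭-prep y (↭-swap x z ↭-refl))))
  ... | inj₂ qs | inj₂ qss = inj₂ (qs ∷ qss)

  split : {P Q : X → Set} → (∀ x → P x ⊎ Q x) → ∀ xs →
          ∃₂ λ ys zs → xs ↭ ys ++ zs × All P ys × All Q zs
  split P⊎Q [] = [] , [] , ↭-refl , [] , []
  split P⊎Q (x ∷ xs) with P⊎Q x | split P⊎Q xs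
  ... | inj₁ p | ys , zs , σ , ps , qs = x ∷ ys , zs , ↭-prep x σ , p ∷ ps , qs
  ... | inj₂ q | ys , zs , σ , ps , qs =
        ys , x ∷ zs , ↭-trans (↭-prep x σ) (↭-sym (shift x ys zs)) , ps , q ∷ qs

  Triangle : Rel X 0ℓ → List X → Set
  Triangle R xs = ∃₂ λ x y → ∃₂ λ z r → xs ↭ x ∷ y ∷ z ∷ r × R x y × R x z × R y z

  Path₄ : Rel X 0ℓ → List X → Set
  Path₄ R xs = ∃₂ λ w x → ∃₂ λ y z → ∃ λ r →
    xs ↭ w ∷ x ∷ y ∷ z ∷ r × R w x × R x y × R y z

  triangle-++ : {R : Rel X 0ℓ} {xs ys zs : List X} → zs ↭ xs ++ ys → Triangle R xs → Triangle R zs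
  triangle-++ {ys = ys} τ (x , y , z , r , σ , t) =
    x , y , z , r ++ ys , ↭-trans τ (++⁺ʳ ys σ) , t

  -- A `P`-edge among the `P`-neighbours `ys` closes a triangle with `v`; without one, three of them
  -- form a `Q`-triangle.
  star : {P Q : Rel X 0ℓ} → (∀ x y → P x y ⊎ Q x y) →
         ∀ {v ys zs xs} → xs ↭ v ∷ ys ++ zs → 3 ≤ length ys → All (P v) ys →
         Triangle P xs ⊎ Triangle Q xs
  star P⊎Q {v} {ys} {zs} σ 3≤ pv with searchPairs P⊎Q ys
  ... | inj₁ (x , y , r , xy , τ) with All-resp-↭ τ pv
  ...   | vx ∷ vy ∷ _ =
          inj₁ (v , x , y , r ++ zs , ↭-trans σ (↭-prep v (++⁺ʳ zs τ)) , vx , vy , xy)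
  star P⊎Q {v} {x ∷ y ∷ z ∷ ys} {zs} σ 3≤ pv | inj₂ ((xy ∷ xz ∷ _) ∷ (yz ∷ _) ∷ _) =
    inj₂ (x , y , z , v ∷ ys ++ zs ,
          ↭-trans σ (↭-sym (shift v (x ∷ y ∷ z ∷ []) (ys ++ zs))) , xy , xz , yz)
  star P⊎Q {ys = _ ∷ []} _ (s≤s ()) _ | inj₂ _
  star P⊎Q {ys = _ ∷ _ ∷ []} _ (s≤s (s≤s ())) _ | inj₂ _

  module _ {P Q : Rel X 0ℓ} (P-sym : Symmetric P) (Q-sym : Symmetric Q)
           (P⊎Q : ∀ x y → P x y ⊎ Q x y) where

    private
      coStar : ∀ {v ys zs xs} → xs ↭ v ∷ ys ++ zs → 3 ≤ length zs → All (Q v) zs →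
               Triangle P xs ⊎ Triangle Q xs
      coStar {v} {ys} {zs} σ 3≤ qv =
        Sum.swap (star (λ x y → Sum.swap (P⊎Q x y)) (↭-trans σ (↭-prep v (++-comm ys zs))) 3≤ qv)

    ramsey₃₃ : ∀ {xs} → 6 ≤ length xs → Triangle P xs ⊎ Triangle Q xs
    ramsey₃₃ {v ∷ xs} (s≤s 5≤) with split (P⊎Q v) xs
    ... | ys , zs , σ , ps , qs with 3 ≤? length ys
    ...   | yes 3≤ = star P⊎Q (↭-prep v σ) 3≤ ps
    ...   | no 3≰ = coStar (↭-prep v σ) (+-cancelˡ-≤ 2 3 (length zs) (begin
              5                     ≤⟨ 5≤ ⟩
              length xs             ≡⟨ ↭-length σ ⟩
              length (ys ++ zs)     ≡⟨ length-++ ys ⟩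
              length ys + length zs ≤⟨ +-monoˡ-≤ (length zs) (≤-pred (≰⇒> 3≰)) ⟩
              2 + length zs         ∎)) qs
      where open ≤-Reasoning

    -- For a graph and its complement on five vertices, only the pentagon avoids both triangles, and
    -- it contains the path. The cases follow the number of `P`-neighbours of `v`.
    triangle⊎path : ∀ {xs} → 5 ≤ length xs → (Triangle P xs ⊎ Triangle Q xs) ⊎ Path₄ P xs
    triangle⊎path {v ∷ xs} (s≤s 4≤) with split (P⊎Q v) xs
    ... | ys , zs , σ , ps , qs =
          go ys zs (↭-prep v σ) ps qs (subst (4 ≤_) (≡.trans (↭-length σ) (length-++ ys)) 4≤)
      where
      go : ∀ ys zs {xs} → xs ↭ v ∷ ys ++ zs → All (P v) ys → All (Q v) zs →
           4 ≤ length ys + length zs → (Triangle P xs ⊎ Triangle Q xs) ⊎ Path₄ P xs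
      go [] zs σ ps qs 4≤ = inj₁ (coStar {ys = []} σ (<⇒≤ 4≤) qs)
      go (x ∷ []) zs σ ps qs (s≤s 3≤) = inj₁ (coStar {ys = [ x ]} σ 3≤ qs)
      go (_ ∷ _ ∷ []) [] _ _ _ (s≤s (s≤s ()))
      -- Unless `x` and `y` close a triangle with `v`, an edge from `z` to one of them prolongs the
      -- path `x v y`, and otherwise `x`, `y`, `z` are pairwise in `Q`.
      go (x ∷ y ∷ []) (z ∷ zs) σ (vx ∷ vy ∷ []) _ _ with P⊎Q x y | P⊎Q z x | P⊎Q z y
      ... | inj₁ xy | _ | _ = inj₁ (inj₁ (v , x , y , z ∷ zs , σ , vx , vy , xy))
      ... | inj₂ xy | inj₁ zx | _ = inj₂ (z , x , v , y , zs ,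
            ↭-trans σ (solve 5 (λ v x y z r → (v ⊕ x ⊕ y ⊕ z ⊕ r) ⊜ (z ⊕ x ⊕ v ⊕ y ⊕ r))
                         ↭-refl [ v ] [ x ] [ y ] [ z ] zs) , zx , P-sym vx , vy)
      ... | inj₂ xy | inj₂ _ | inj₁ zy = inj₂ (z , y , v , x , zs ,
            ↭-trans σ (solve 5 (λ v x y z r → (v ⊕ x ⊕ y ⊕ z ⊕ r) ⊜ (z ⊕ y ⊕ v ⊕ x ⊕ r))
                         ↭-refl [ v ] [ x ] [ y ] [ z ] zs) , zy , P-sym vy , vx)
      ... | inj₂ xy | inj₂ zx | inj₂ zy = inj₁ (inj₂ (x , y , z , v ∷ zs ,
            ↭-trans σ (↭-sym (shift v (x ∷ y ∷ z ∷ []) zs)) , xy , Q-sym zx , Q-sym zy))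
      go (_ ∷ _ ∷ _ ∷ _) zs σ ps _ _ = inj₁ (star P⊎Q σ (s≤s (s≤s (s≤s z≤n))) ps)

-- Matchings in the complement and their improvements.

module _ {n : ℕ} (G : Graph n) where

  open import Algebra.Solver.CommutativeMonoid (++-commutativeMonoid {A = Fin n})

  private
    V = Fin n

  -- `N` is adjacency in H, but holds also between a vertex and itself. So an independent list may
  -- repeat a vertex, whereas `AllPairs A` forces distinct entries.
  A N : V → V → Set
  A = Adj G
  N x y = adj G x y ≡ false

  N⊎A : ∀ x y → N x y ⊎ A x y
  N⊎A x y with adj G x y
  ... | true  = inj₂ refl
  ... | false = inj₁ refl

  A-sym : Symmetric A
  A-sym {x} {y} = ≡.trans (Graph.sym G y x)

  N-sym : Symmetric N
  N-sym {x} {y} = ≡.trans (Graph.sym G y x)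

  N⇒¬A : ∀ {x y} → N x y → ¬ A x y
  N⇒¬A nxy axy with () ← ≡.trans (≡.sym nxy) axy

  vertices : List V → List (V × V) → List V
  vertices U ps = U ++ map proj₁ ps ++ map proj₂ ps

  vertices-↭ : ∀ {U U′ ps ps′} → U ↭ U′ → ps ↭ ps′ → vertices U ps ↭ vertices U′ ps′
  vertices-↭ σ τ = ++⁺ σ (++⁺ (map⁺ proj₁ τ) (map⁺ proj₂ τ))

  vertices-∷ : ∀ U a b ps → vertices U ((a , b) ∷ ps) ↭ a ∷ b ∷ vertices U ps
  vertices-∷ U a b ps = solve 5 (λ U a F b S → (U ⊕ (a ⊕ F) ⊕ (b ⊕ S)) ⊜ ((a ⊕ b) ⊕ (U ⊕ F ⊕ S)))
    ↭-refl U [ a ] (map proj₁ ps) [ b ] (map proj₂ ps)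

  -- In the complement of G, ps is to be a matching and U the set of unmatched vertices.
  data Improvement (U : List V) (ps : List (V × V)) : Set where
    triangle : Triangle N (vertices U ps) → Improvement U ps
    augment  : ∀ U′ ps′ → All (uncurry N) ps′ → 2 + length U′ ≡ length U →
               vertices U ps ↭ vertices U′ ps′ → Improvement U ps

  improvement-↭ : ∀ {U U′ ps ps′} → vertices U ps ↭ vertices U′ ps′ → length U′ ≡ length U →
                  Improvement U′ ps′ → Improvement U ps
  improvement-↭ σ eq (triangle (x , y , z , r , τ , t)) = triangle (x , y , z , r , ↭-trans σ τ , t)
  improvement-↭ σ eq (augment U″ ps″ ns eq′ τ) = augment U″ ps″ ns (≡.trans eq′ eq) (↭-trans σ τ)

  CliqueOfSize : ℕ → Set
  CliqueOfSize m = ∃ λ C → AllPairs A C × m ≤ length C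

  Oriented : List V → V × V → Set
  Oriented U (a , b) = N a b × All (A b) U

  private
    -- The ways in which both ends of a matched pair can have H-neighbours in `U`: two entries give
    -- the augmenting path `u a b v`, a common one gives a triangle of H.
    Conflict : List V → V × V → Set
    Conflict U (a , b) =
      (∃₂ λ u v → ∃ λ r → U ↭ u ∷ v ∷ r × N u a × N v b) ⊎
      (∃₂ λ u r → U ↭ u ∷ r × N u a × N u b)

  orient₁ : ∀ U p → Conflict U p ⊎ (All (A (proj₁ p)) U ⊎ All (A (proj₂ p)) U)
  orient₁ U (a , b) with search (N⊎A a) U
  ... | inj₂ as = inj₂ (inj₁ as)
  ... | inj₁ (u , r , au , σ) with search (N⊎A b) r
  ...   | inj₁ (v , r′ , bv , τ) =
            inj₁ (inj₁ (u , v , r′ , ↭-trans σ (↭-prep u τ) , N-sym au , N-sym bv))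
  -- Only `u` can still be an H-neighbour of `b`.
  ...   | inj₂ bs with N⊎A b u
  ...     | inj₁ bu = inj₁ (inj₂ (u , r , σ , N-sym au , N-sym bu))
  ...     | inj₂ bu = inj₂ (inj₂ (All-resp-↭ (↭-sym σ) (bu ∷ bs)))

  conflict⇒improvement : ∀ {U p ps qs} → Conflict U p → qs ↭ p ∷ ps → All (uncurry N) qs →
                         Improvement U qs
  conflict⇒improvement {U} {a , b} {ps} (inj₁ (u , v , r , σ , ua , vb)) τ ns with All-resp-↭ τ ns
  ... | _ ∷ ns′ = augment r ((u , a) ∷ (v , b) ∷ ps) (ua ∷ vb ∷ ns′)
    (≡.sym (↭-length σ))
    (↭-trans (vertices-↭ σ τ)
      (solve 7 (λ u v r a b F S → ((u ⊕ v ⊕ r) ⊕ (a ⊕ F) ⊕ (b ⊕ S))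
                                  ⊜ (r ⊕ (u ⊕ v ⊕ F) ⊕ (a ⊕ b ⊕ S)))
        ↭-refl [ u ] [ v ] r [ a ] [ b ] (map proj₁ ps) (map proj₂ ps)))
  conflict⇒improvement {U} {a , b} {ps} (inj₂ (u , r , σ , ua , ub)) τ ns with All-resp-↭ τ ns
  ... | ab ∷ _ = triangle (u , a , b , r ++ map proj₁ ps ++ map proj₂ ps ,
    ↭-trans (vertices-↭ σ τ)
      (solve 6 (λ u r a b F S → ((u ⊕ r) ⊕ (a ⊕ F) ⊕ (b ⊕ S)) ⊜ (u ⊕ a ⊕ b ⊕ r ⊕ F ⊕ S))
        ↭-refl [ u ] r [ a ] [ b ] (map proj₁ ps) (map proj₂ ps)) , ua , ub , ab)

  orientAll : ∀ U ps → All (uncurry N) ps →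
              All (λ p → All (A (proj₁ p)) U ⊎ All (A (proj₂ p)) U) ps →
              ∃ λ qs → All (Oriented U) qs × vertices U ps ↭ vertices U qs × length qs ≡ length ps
  orientAll U [] [] [] = [] , [] , ↭-refl , refl
  orientAll U ((a , b) ∷ ps) (ab ∷ ns) (o ∷ os) with orientAll U ps ns os
  ... | qs , oqs , σ , eq with ↭-trans (vertices-∷ U a b ps) (++⁺ˡ (a ∷ b ∷ []) σ) | o
  ...   | τ | inj₂ bU = (a , b) ∷ qs , (ab , bU) ∷ oqs ,
          ↭-trans τ (↭-sym (vertices-∷ U a b qs)) , cong suc eq
  ...   | τ | inj₁ aU = (b , a) ∷ qs , (N-sym ab , aU) ∷ oqs ,
          ↭-trans τ (↭-trans (↭-swap a b ↭-refl) (↭-sym (vertices-∷ U b a qs))) , cong suc eq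

  orient : ∀ U ps → All (uncurry N) ps → Improvement U ps ⊎
           ∃ λ qs → All (Oriented U) qs × vertices U ps ↭ vertices U qs × length qs ≡ length ps
  orient U ps ns with search (orient₁ U) ps
  ... | inj₁ (_ , _ , c , σ) = inj₁ (conflict⇒improvement c σ ns)
  ... | inj₂ os              = inj₂ (orientAll U ps ns os)

  -- For v in U, the path u a b b′ a′ v of H through the two matched pairs is augmenting.
  link : ∀ {U u r a b a′ b′ ps qs} → U ↭ u ∷ r → qs ↭ (a , b) ∷ (a′ , b′) ∷ ps → All (uncurry N) qs →
         N u a → N b b′ → Any (N a′) U → Improvement U qs ⊎ (N u a′ × All (A a′) r)
  link {u = u} {r} {a} {b} {a′} {b′} {ps} σ τ ns ua bb′ i with search (N⊎A a′) r
  ... | inj₁ (v , r′ , a′v , ρ) with All-resp-↭ τ ns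
  ...   | _ ∷ _ ∷ ns′ = inj₁ (augment r′ ((u , a) ∷ (b , b′) ∷ (a′ , v) ∷ ps)
          (ua ∷ bb′ ∷ a′v ∷ ns′) (≡.sym (↭-length (↭-trans σ (↭-prep u ρ))))
          (↭-trans (vertices-↭ (↭-trans σ (↭-prep u ρ)) τ)
            (solve 9 (λ u v r a b a′ b′ F S → ((u ⊕ v ⊕ r) ⊕ (a ⊕ a′ ⊕ F) ⊕ (b ⊕ b′ ⊕ S))
                                              ⊜ (r ⊕ (u ⊕ b ⊕ a′ ⊕ F) ⊕ (a ⊕ b′ ⊕ v ⊕ S)))
              ↭-refl [ u ] [ v ] r′ [ a ] [ b ] [ a′ ] [ b′ ] (map proj₁ ps) (map proj₂ ps))))
  -- By `i`, some H-neighbour of `a′` lies in `U`; as none lies in `r`, it is `u`.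
  link {u = u} {a′ = a′} σ τ ns ua bb′ i | inj₂ as with N⊎A a′ u | Any-resp-↭ σ i
  ... | inj₁ a′u | _          = inj₂ (N-sym a′u , as)
  ... | inj₂ a′u | here n     = ⊥-elim (N⇒¬A n a′u)
  ... | inj₂ a′u | there j    = ⊥-elim (All¬⇒¬Any (All.map (λ ax nx → N⇒¬A nx ax) as) j)

  path : ∀ {U qs} → AllPairs A U → All (uncurry N) qs → All (λ q → Any (N (proj₁ q)) U) qs →
         Path₄ {V × V} (N on proj₂) qs → Improvement U qs ⊎ CliqueOfSize (length U + 3)
  path {U} {qs} U! ns is (p₁@(a₁ , _) , p₂@(a₂ , _) , p₃@(a₃ , _) , p₄@(a₄ , _) , ps , σ , n₁₂ , n₂₃ , n₃₄)
    with All-resp-↭ σ is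
  ... | i₁ ∷ i₂ ∷ i₃ ∷ i₄ ∷ _ with extract i₁
  ...   | u , r , a₁u , τ = go (link τ σ ns (N-sym a₁u) n₁₂ i₂)
    where
    as = a₁ ∷ a₂ ∷ a₃ ∷ a₄ ∷ []
    bs = map proj₂ (p₁ ∷ p₂ ∷ p₃ ∷ p₄ ∷ ps)

    σ₂₁ : qs ↭ p₂ ∷ p₁ ∷ p₃ ∷ p₄ ∷ ps
    σ₂₁ = ↭-trans σ (↭-swap p₁ p₂ ↭-refl)

    σ₂₃ : qs ↭ p₂ ∷ p₃ ∷ p₁ ∷ p₄ ∷ ps
    σ₂₃ = ↭-trans σ₂₁ (↭-prep p₂ (↭-swap p₁ p₃ ↭-refl))

    σ₃₄ : qs ↭ p₃ ∷ p₄ ∷ p₁ ∷ p₂ ∷ ps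
    σ₃₄ = ↭-trans σ (shifts (p₁ ∷ p₂ ∷ []) (p₃ ∷ p₄ ∷ []))

    -- Two of the `as` joined in H form a triangle with `u`; otherwise all four replace `u` in the
    -- clique, a net gain of three.
    finish : All (N u) as → All (λ a → All (A a) r) as →
             Improvement U qs ⊎ CliqueOfSize (length U + 3)
    finish nu ar with searchPairs N⊎A as
    ... | inj₁ (x , y , r′ , xy , ρ) with All-resp-↭ ρ nu
    ...   | ux ∷ uy ∷ _ = inj₁ (triangle (u , x , y , r ++ r′ ++ map proj₁ ps ++ bs ,
        ↭-trans (vertices-↭ τ σ) (↭-trans (++⁺ˡ (u ∷ r) (++⁺ʳ bs (++⁺ʳ (map proj₁ ps) ρ)))
          (solve 7 (λ u r x y r′ F S → ((u ⊕ r) ⊕ ((x ⊕ y ⊕ r′) ⊕ F) ⊕ S)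
                                       ⊜ (u ⊕ x ⊕ y ⊕ r ⊕ r′ ⊕ F ⊕ S))
            ↭-refl [ u ] r [ x ] [ y ] r′ (map proj₁ ps) bs)) ,
        ux , uy , xy))
    finish nu ar | inj₂ as! = inj₂ (as ++ r ,
      AllPairsₚ.++⁺ as! (AllPairs.tail (AllPairs-resp-↭ (≡.setoid V) A-sym (≡.resp₂ A) (↭⇒↭ₛ τ) U!)) ar ,
      ≤-reflexive (≡.trans (+-comm (length U) 3) (cong (3 +_) (↭-length τ))))

    go : Improvement U qs ⊎ (N u a₂ × All (A a₂) r) → Improvement U qs ⊎ CliqueOfSize (length U + 3)
    go (inj₁ imp) = inj₁ imp
    -- The link from the second pair back to the first shows that `u`, chosen merely as some
    -- H-neighbour of `a₁`, is its only one in `U`.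
    go (inj₂ (ua₂ , ar₂)) with link τ σ₂₁ ns ua₂ (N-sym n₁₂) i₁ | link τ σ₂₃ ns ua₂ n₂₃ i₃
    ... | inj₁ imp | _ = inj₁ imp
    ... | inj₂ _   | inj₁ imp = inj₁ imp
    ... | inj₂ (ua₁ , ar₁) | inj₂ (ua₃ , ar₃) with link τ σ₃₄ ns ua₃ n₃₄ i₄
    ...   | inj₁ imp = inj₁ imp
    ...   | inj₂ (ua₄ , ar₄) = finish (ua₁ ∷ ua₂ ∷ ua₃ ∷ ua₄ ∷ []) (ar₁ ∷ ar₂ ∷ ar₃ ∷ ar₄ ∷ [])

  -- Extending `U` to a larger clique.

  triangle⇒clique : ∀ {U W} → AllPairs A U → All (λ w → All (A w) U) W → Triangle A W →
                    CliqueOfSize (length U + 3)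
  triangle⇒clique {U} U! WU (x , y , z , r , σ , xy , xz , yz) with All-resp-↭ σ WU
  ... | xU ∷ yU ∷ zU ∷ _ = x ∷ y ∷ z ∷ U ,
        (xy ∷ xz ∷ xU) ∷ (yz ∷ yU) ∷ zU ∷ U! , ≤-reflexive (+-comm (length U) 3)

  triangle-proj₂ : ∀ {R : V → V → Set} {qs} → Triangle {V × V} (R on proj₂) qs → Triangle R (map proj₂ qs)
  triangle-proj₂ (x , y , z , r , σ , t) =
    proj₂ x , proj₂ y , proj₂ z , map proj₂ r , map⁺ proj₂ σ , t

  private
    vertices-proj₂ : ∀ U qs → vertices U qs ↭ map proj₂ qs ++ (U ++ map proj₁ qs)
    vertices-proj₂ U qs =
      solve 3 (λ U F S → (U ⊕ F ⊕ S) ⊜ (S ⊕ U ⊕ F)) ↭-refl U (map proj₁ qs) (map proj₂ qs)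

  extendBy3 : ∀ {U qs} → AllPairs A U → All (Oriented U) qs → 5 ≤ length qs →
            Improvement U qs ⊎ CliqueOfSize (length U + 3)
  extendBy3 {U} {qs} U! os 5≤ with search (λ q → All.decide (Sum.swap ∘ N⊎A (proj₁ q)) U) qs
  ... | inj₂ is with triangle⊎path (λ {_} {_} → N-sym) (λ {_} {_} → A-sym) (λ p q → N⊎A (proj₂ p) (proj₂ q)) 5≤
  ...   | inj₁ (inj₁ t) = inj₁ (triangle (triangle-++ (vertices-proj₂ U qs) (triangle-proj₂ {N} t)))
  ...   | inj₁ (inj₂ t) = inj₂ (triangle⇒clique U! (All-map⁺ (All.map proj₂ os)) (triangle-proj₂ {A} t))
  ...   | inj₂ p = path U! (All.map proj₁ os) is p
  -- The six vertices are `a` and the second entries of all pairs, that of `q` included; each is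
  -- complete to `U` in G.
  extendBy3 {U} {qs} U! os 5≤ | inj₁ (q@(a , b) , r , aU , σ) with
    ramsey₃₃ N-sym A-sym N⊎A {a ∷ map proj₂ (q ∷ r)}
      (s≤s (≤-trans 5≤ (≤-reflexive (≡.trans (↭-length σ) (≡.sym (length-map proj₂ (q ∷ r)))))))
  ... | inj₁ t = inj₁ (triangle (triangle-++ (↭-trans (vertices-↭ ↭-refl σ)
         (solve 4 (λ U a F S → (U ⊕ (a ⊕ F) ⊕ S) ⊜ ((a ⊕ S) ⊕ (U ⊕ F)))
           ↭-refl U [ a ] (map proj₁ r) (map proj₂ (q ∷ r)))) t))
  ... | inj₂ t = inj₂ (triangle⇒clique U! (aU ∷ All-map⁺ (All.map proj₂ (All-resp-↭ σ os))) t)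

  -- For `s` equal to 1, 2, 3 there are at least 1, 3, 5 second entries to choose from. One can be
  -- added outright; of three, two are adjacent in G or all form a triangle of H; five are left to
  -- `extendBy3`.
  extendBy : ∀ s {U qs} → s ≤ 3 → 2 * s ≤ suc (length qs) → AllPairs A U → All (Oriented U) qs →
           Improvement U qs ⊎ CliqueOfSize (length U + s)
  extendBy 0 {U} _ _ U! _ = inj₂ (U , U! , ≤-reflexive (+-identityʳ (length U)))
  extendBy 1 {U} {[]} _ (s≤s ()) _ _
  extendBy 1 {U} {(a , b) ∷ _} _ _ U! ((_ , bU) ∷ _) =
    inj₂ (b ∷ U , bU ∷ U! , ≤-reflexive (+-comm (length U) 1))
  extendBy 2 {U} {qs} _ 4≤ U! os with searchPairs (λ p q → Sum.swap (N⊎A (proj₂ p) (proj₂ q))) qs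
  ... | inj₁ ((a , b) , (a′ , b′) , r , bb′ , σ) with All-resp-↭ σ os
  ...   | (_ , bU) ∷ (_ , b′U) ∷ _ =
          inj₂ (b ∷ b′ ∷ U , (bb′ ∷ bU) ∷ b′U ∷ U! , ≤-reflexive (+-comm (length U) 2))
  extendBy 2 {U} {x ∷ y ∷ z ∷ r} _ _ U! os | inj₂ ((xy ∷ xz ∷ _) ∷ (yz ∷ _) ∷ _) =
    inj₁ (triangle (triangle-++ (vertices-proj₂ U (x ∷ y ∷ z ∷ r))
      (triangle-proj₂ {N} (x , y , z , r , ↭-refl , xy , xz , yz))))
  extendBy 2 {U} {[]} _ (s≤s ()) _ _ | inj₂ _
  extendBy 2 {U} {_ ∷ []} _ (s≤s (s≤s ())) _ _ | inj₂ _
  extendBy 2 {U} {_ ∷ _ ∷ []} _ (s≤s (s≤s (s≤s ()))) _ _ | inj₂ _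
  extendBy 3 _ (s≤s 5≤) U! os = extendBy3 U! os 5≤
  extendBy (suc (suc (suc (suc s)))) (s≤s (s≤s (s≤s ()))) _ _ _

  -- Partitions into independent sets, and the induction on `j`.

  Partition : ℕ → List V → Set
  Partition m zs = ∃ λ Cs → length Cs < m × All (AllPairs N) Cs × zs ⊆ concat Cs

  partition-⊆ : ∀ {m zs zs′} → zs ⊆ zs′ → Partition m zs′ → Partition m zs
  partition-⊆ s (Cs , l , i , c) = Cs , l , i , c ∘ s

  concat-singletons : ∀ U → All (AllPairs N) (map [_] U) × U ⊆ concat (map [_] U)
  concat-singletons U = All-map⁺ (All.tabulate λ _ → [] ∷ []) ,
    λ i → subst (_ ∈_) (≡.sym (concat-map-[_] U)) i

  matching⇒partition : ∀ {m} U ps → All (uncurry N) ps → length U + length ps < m →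
                       Partition m (vertices U ps)
  matching⇒partition {m} U [] [] l =
    map [_] U , subst (_< m) (≡.trans (+-identityʳ (length U)) (≡.sym (length-map [_] U))) l ,
    proj₁ (concat-singletons U) ,
    λ i → proj₂ (concat-singletons U) (subst (_ ∈_) (++-identityʳ U) i)
  matching⇒partition {zero} U (_ ∷ ps) _ ()
  matching⇒partition {suc m} U ((a , b) ∷ ps) (n ∷ ns) l
    with matching⇒partition {m} U ps ns (≤-pred (subst (_< suc m) (+-suc (length U) (length ps)) l))
  ... | Cs , l′ , is , c = (a ∷ b ∷ []) ∷ Cs , s≤s l′ , ((n ∷ []) ∷ [] ∷ []) ∷ is ,
        cover ∘ ∈-resp-↭ (vertices-∷ U a b ps)
    where
    cover : a ∷ b ∷ vertices U ps ⊆ a ∷ b ∷ concat Cs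
    cover (here e)          = here e
    cover (there (here e))  = there (here e)
    cover (there (there i)) = there (there (c i))

  length-vertices : ∀ U ps → length (vertices U ps) ≡ length U + (length ps + length ps)
  length-vertices U ps = ≡.trans (length-++ U) (cong (length U +_)
    (≡.trans (length-++ (map proj₁ ps)) (≡.cong₂ _+_ (length-map proj₁ ps) (length-map proj₂ ps))))

  Dichotomy : ℕ → ℕ → List V → Set
  Dichotomy k j zs = CliqueOfSize (suc k) ⊎ Partition (k + j) zs

  private
    -- Here `u` and `m` count unmatched vertices and matched pairs. Subtracting the first hypothesis
    -- from the second leaves `m ≤ 2 * j + 1`, so `s = m ∸ j` is at most `j + 1`, and adding `s`
    -- gives `2 * s ≤ m + 1`.
    excess : ∀ {k j u m} → k + suc j ≤ u + m → u + (m + m) < k + 3 * suc j →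
             m ∸ j ≤ suc j × 2 * (m ∸ j) ≤ suc m × suc k ≤ u + (m ∸ j)
    excess {k} {j} {u} {m} k+j≤ <k+3j = s≤ , 2s≤ , k<
      where
      open ≤-Reasoning
      s = m ∸ j
      m≤ : m ≤ j + suc j
      m≤ = ≤-pred (+-cancelˡ-≤ (k + suc j) (suc m) (suc (j + suc j)) (begin
        (k + suc j) + suc m   ≡⟨ +-suc (k + suc j) m ⟩
        suc (k + suc j + m)   ≤⟨ s≤s (+-monoˡ-≤ m k+j≤) ⟩
        suc (u + m + m)       ≡⟨ cong suc (+-assoc u m m) ⟩
        suc (u + (m + m))     ≤⟨ <k+3j ⟩
        k + 3 * suc j         ≡⟨ lem k j ⟩
        (k + suc j) + suc (j + suc j) ∎))
        where
        lem : ∀ k j → k + 3 * suc j ≡ (k + suc j) + suc (j + suc j)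
        lem = solve-∀
      s≤ : s ≤ suc j
      s≤ = m≤n+o⇒m∸n≤o m j m≤
      2s≤ : 2 * s ≤ suc m
      2s≤ with ≤-total j m
      ... | inj₁ j≤m = begin
        2 * s       ≡⟨ cong (s +_) (+-identityʳ s) ⟩
        s + s       ≤⟨ +-monoˡ-≤ s s≤ ⟩
        suc (j + s) ≡⟨ cong suc (m+[n∸m]≡n j≤m) ⟩
        suc m       ∎
      -- With at most `j` pairs the truncated difference is zero.
      ... | inj₂ m≤j = subst (λ t → 2 * t ≤ suc m) (≡.sym (m≤n⇒m∸n≡0 m≤j)) z≤n
      k< : suc k ≤ u + s
      k< = +-cancelʳ-≤ j (suc k) (u + s) (begin
        suc k + j    ≡⟨ +-suc k j ⟨
        k + suc j    ≤⟨ k+j≤ ⟩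
        u + m        ≤⟨ +-monoʳ-≤ u (m≤n+m∸n m j) ⟩
        u + (j + s)  ≡⟨ cong (u +_) (+-comm j s) ⟩
        u + (s + j)  ≡⟨ +-assoc u s j ⟨
        u + s + j    ∎)

  improveOrDecide : ∀ {k j} U ps → j ≤ 2 → All (uncurry N) ps → length (vertices U ps) < k + 3 * suc j →
         Improvement U ps ⊎ Dichotomy k (suc j) (vertices U ps)
  improveOrDecide {k} {j} U ps j≤2 ns l with searchPairs N⊎A U
  ... | inj₁ (u , v , r , uv , σ) = inj₁ (augment r ((u , v) ∷ ps) (uv ∷ ns) (≡.sym (↭-length σ))
        (↭-trans (vertices-↭ {ps = ps} σ ↭-refl)
          (solve 5 (λ u v r F S → ((u ⊕ v ⊕ r) ⊕ F ⊕ S) ⊜ (r ⊕ (u ⊕ F) ⊕ (v ⊕ S)))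
            ↭-refl [ u ] [ v ] r (map proj₁ ps) (map proj₂ ps))))
  ... | inj₂ U! with length U + length ps <? k + suc j
  ...   | yes < = inj₂ (inj₂ (matching⇒partition U ps ns <))
  ...   | no ≮ with orient U ps ns
  ...     | inj₁ imp = inj₁ imp
  ...     | inj₂ (qs , os , σ , eq)
    with excess {k} {j} {length U} (≮⇒≥ ≮) (subst (_< _) (length-vertices U ps) l)
  ...       | s≤ , 2s≤ , k<
    -- The bound `j ≤ 2` is spent here: it keeps the required gain within the three that `extendBy`
    -- can supply.
    with extendBy _ (≤-trans s≤ (s≤s j≤2)) (subst (λ t → _ ≤ suc t) (≡.sym eq) 2s≤) U! os
  ...         | inj₁ imp           = inj₁ (improvement-↭ σ refl imp)
  ...         | inj₂ (C , C! , ≤C) = inj₂ (inj₁ (C , C! , ≤-trans k< ≤C))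

  dichotomy : ∀ j k zs → j ≤ 3 → length zs < k + 3 * j → Dichotomy k j zs
  -- The number `b` ensures termination: an augmentation takes two vertices out of `U` and lowers
  -- `b` at the same `j`, while a triangle returns to `dichotomy` at a smaller `j`.
  improve   : ∀ j k b U ps → j ≤ 2 → All (uncurry N) ps → length U < b →
              length (vertices U ps) < k + 3 * suc j → Dichotomy k (suc j) (vertices U ps)

  dichotomy zero k zs _ l =
    inj₂ (map [_] zs , subst (_< k + 0) (≡.sym (length-map [_] zs)) l , concat-singletons zs)
  dichotomy (suc j) k zs (s≤s j≤2) l = Sum.map₂
    (partition-⊆ (λ i → subst (_ ∈_) (≡.sym (++-identityʳ zs)) i))
    (improve j k _ zs [] j≤2 [] ≤-refl (subst (_< _) (cong length (≡.sym (++-identityʳ zs))) l))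

  improve j k (suc b) U ps j≤2 ns (s≤s U≤b) l with improveOrDecide {k} {j} U ps j≤2 ns l
  ... | inj₂ d = d
  ... | inj₁ (augment U′ ps′ ns′ eq σ) =
        Sum.map₂ (partition-⊆ (∈-resp-↭ σ))
          (improve j k b U′ ps′ j≤2 ns′ (<⇒≤ (subst (_≤ b) (≡.sym eq) U≤b))
            (subst (_< _) (↭-length σ) l))
  ... | inj₁ (triangle (x , y , z , r , σ , xy , xz , yz)) =
        Sum.map₂ addClass (dichotomy j k r (m≤n⇒m≤1+n j≤2) (+-cancelˡ-< 3 _ _ (begin-strict
          3 + length r            ≡⟨ ↭-length σ ⟨
          length (vertices U ps)  <⟨ l ⟩
          k + 3 * suc j           ≡⟨ lem k j ⟩
          3 + (k + 3 * j)         ∎)))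
    where
    open ≤-Reasoning
    lem : ∀ k j → k + 3 * suc j ≡ 3 + (k + 3 * j)
    lem = solve-∀
    addClass : Partition (k + j) r → Partition (k + suc j) (vertices U ps)
    addClass (Cs , Cs< , is , c) = (x ∷ y ∷ z ∷ []) ∷ Cs ,
      subst (suc (length Cs) <_) (≡.sym (+-suc k j)) (s≤s Cs<) ,
      ((xy ∷ xz ∷ []) ∷ (yz ∷ []) ∷ [] ∷ []) ∷ is , cover ∘ ∈-resp-↭ σ
      where
      cover : x ∷ y ∷ z ∷ r ⊆ x ∷ y ∷ z ∷ concat Cs
      cover (here e)                  = here e
      cover (there (here e))          = there (here e)
      cover (there (there (here e)))  = there (there (here e))
      cover (there (there (there i))) = there (there (there (c i)))

-- From lists back to cliques and colourings: the lower bound.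

AllPairs-lookup : ∀ {X : Set} {R : Rel X 0ℓ} {xs} → Symmetric R → AllPairs R xs →
                  ∀ i j → i ≢ j → R (lookup xs i) (lookup xs j)
AllPairs-lookup R-sym (r ∷ rs) zero    zero    i≢j = ⊥-elim (i≢j refl)
AllPairs-lookup R-sym (r ∷ rs) zero    (suc j) i≢j = All.lookup r (∈-lookup j)
AllPairs-lookup R-sym (r ∷ rs) (suc i) zero    i≢j = R-sym (All.lookup r (∈-lookup i))
AllPairs-lookup R-sym (r ∷ rs) (suc i) (suc j) i≢j = AllPairs-lookup R-sym rs i j (i≢j ∘ cong suc)

AllPairs-++⁻ˡ : ∀ {X : Set} {R : Rel X 0ℓ} xs {ys} → AllPairs R (xs ++ ys) → AllPairs R xs
AllPairs-++⁻ˡ []       _        = []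
AllPairs-++⁻ˡ (x ∷ xs) (r ∷ rs) = ++⁻ˡ xs r ∷ AllPairs-++⁻ˡ xs rs

module _ {n : ℕ} (G : Graph n) where

  listClique : ∀ {xs} → AllPairs (A G) xs → IsClique G (length xs) (lookup xs)
  listClique = AllPairs-lookup (A-sym G)

  cliqueOfSize⇒HasClique : ∀ {p} → CliqueOfSize G p → HasClique G p
  cliqueOfSize⇒HasClique (C , C! , p≤) =
    (λ i → lookup C (inject≤ i p≤)) ,
    λ i j i≢j → listClique C! _ _ (i≢j ∘ inject≤-injective p≤ p≤ i j)

  independent : ∀ {C x y} → AllPairs (N G) C → x ∈ C → y ∈ C → N G x y
  independent (ns ∷ C!) (here refl) (here refl) = loopless G _
  independent (ns ∷ C!) (here refl) (there j)   = All.lookup ns j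
  independent (ns ∷ C!) (there i)   (here refl) = N-sym G (All.lookup ns i)
  independent (ns ∷ C!) (there i)   (there j)   = independent C! i j

  -- Each vertex is coloured by the index of a class in which it is found; the ends of a
  -- monochromatic edge would then lie in one independent set.
  partition⇒¬VArrows : ∀ {r} → Partition G (suc r) (allFin n) → ¬ VArrows G r (twos r)
  partition⇒¬VArrows {r} (Cs , s≤s Cs≤r , Cs! , cover) arrows
    with arrows (λ x → inject≤ (index (∈-concat⁻ Cs (cover (∈-allFin x)))) Cs≤r)
  ... | i , f , clique , mono = N⇒¬A G
    (independent (All.lookup Cs! (∈-lookup j)) (lookup-index (class (f zero)))
      (subst (λ k → f (suc zero) ∈ lookup Cs k) (≡.sym same) (lookup-index (class (f (suc zero))))))
    (clique zero (suc zero) λ ())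
    where
    class : ∀ x → Any (x ∈_) Cs
    class x = ∈-concat⁻ Cs (cover (∈-allFin x))
    j = index (class (f zero))
    same : j ≡ index (class (f (suc zero)))
    same = inject≤-injective Cs≤r Cs≤r _ _ (≡.trans (mono zero) (≡.sym (mono (suc zero))))

-- With `r = 2 + k` the numbers of `dichotomy` at `j = 3` fit: `k + 9` is `r + 7`, a clique on
-- `k + 1` vertices is one on `r ∸ 1`, and fewer than `k + 3` classes are at most `r`.
¬InHv : ∀ {n} k (G : Graph n) → n < k + 9 → ¬ InHv G (2 + k) (1 + k)
¬InHv {n} k G n< (arrows , ¬clique)
  with dichotomy G 3 k (allFin n) ≤-refl (subst (_< k + 9) (≡.sym (length-tabulate id)) n<)
... | inj₁ clique    = ¬clique (cliqueOfSize⇒HasClique G clique)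
... | inj₂ partition = partition⇒¬VArrows G
                         (subst (λ m → Partition G m (allFin n)) (+-comm k 3) partition) arrows

-- Arrowing from a small independence number.

pigeonhole : ∀ {X : Set} {r} (c : X → Fin r) a cs xs → All (λ x → c x ∈ cs) xs →
             length cs * a < length xs →
             ∃ λ i → ∃₂ λ ys zs → xs ↭ ys ++ zs × All (λ y → c y ≡ i) ys × a < length ys
pigeonhole c a []       (x ∷ xs) (() ∷ _) _
pigeonhole c a (i ∷ cs) xs       c∈ l
  with split (λ x → toSum (c x ≟ᶠ i)) xs
... | ys , zs , σ , ys≡ , zs≢ with a <? length ys
...   | yes a< = i , ys , zs , σ , ys≡ , a<
...   | no a≮ with pigeonhole c a cs zs zs∈ (+-cancelˡ-< a _ _ (begin-strict
            a + length cs * a     <⟨ l ⟩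
            length xs             ≡⟨ ↭-length σ ⟩
            length (ys ++ zs)     ≡⟨ length-++ ys ⟩
            length ys + length zs ≤⟨ +-monoˡ-≤ (length zs) (≮⇒≥ a≮) ⟩
            a + length zs         ∎))
  where
  open ≤-Reasoning
  zs∈ : All (λ x → c x ∈ cs) zs
  zs∈ = All.zipWith (λ { (here e , ≢) → ⊥-elim (≢ e) ; (there i , _) → i })
          (++⁻ʳ ys (All-resp-↭ σ c∈) , zs≢)
...     | j , ys′ , zs′ , τ , ≡j , a< =
          j , ys′ , ys ++ zs′ , ↭-trans σ (↭-trans (++⁺ˡ ys τ) (shifts ys ys′)) , ≡j , a<

complement : ∀ {n} → Graph n → Graph n
complement G .adj x y       = not (adj G x y) ∧ not (does (x ≟ᶠ y))
complement G .Graph.sym x y = ≡.cong₂ (λ b d → not b ∧ not d) (Graph.sym G x y)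
                                (does-⇔ (mk⇔ ≡.sym ≡.sym) (x ≟ᶠ y) (y ≟ᶠ x))
complement G .loopless x rewrite dec-true (x ≟ᶠ x) refl = ∧-zeroʳ _

N⇒complement : ∀ {n} (G : Graph n) {x y} → N G x y → x ≢ y → Adj (complement G) x y
N⇒complement G {x} {y} nxy x≢y rewrite nxy | dec-false (x ≟ᶠ y) x≢y = refl

-- A colour class with more than `a` vertices and no edge would give a clique of the complement on
-- `suc a` vertices.
pigeonhole⇒VArrows : ∀ {n} (G : Graph n) a r → CliqueNumberBelow (complement G) (suc a) → r * a < n →
         VArrows G r (twos r)
pigeonhole⇒VArrows {n} G a r ¬clique l c
  with pigeonhole c a (allFin r) (allFin n) (All.tabulate λ {x} _ → ∈-allFin (c x))
         (≡.subst₂ (λ r n → r * a < n) (≡.sym (length-tabulate {n = r} id))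
                                       (≡.sym (length-tabulate {n = n} id)) l)
... | i , ys , zs , σ , c≡i , a< with searchPairs (λ x y → Sum.swap (N⊎A G x y)) ys
...   | inj₁ (x , y , r′ , xy , τ) with All-resp-↭ τ c≡i
...     | cx ∷ cy ∷ _ = i , lookup (x ∷ y ∷ []) , listClique G ((xy ∷ []) ∷ [] ∷ []) ,
          λ k → All.lookup {P = λ v → c v ≡ i} (cx ∷ cy ∷ []) (∈-lookup k)
pigeonhole⇒VArrows {n} G a r ¬clique l c | i , ys , zs , σ , c≡i , a< | inj₂ ns =
  ⊥-elim (¬clique (cliqueOfSize⇒HasClique (complement G)
    (ys , AllPairs.zipWith (λ (nxy , x≢y) → N⇒complement G nxy x≢y) (ns , ys!) , a<)))
  where
  -- Adjacency in the complement is `N` between distinct vertices; distinctness is inherited from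
  -- `allFin n`.
  ys! : AllPairs _≢_ ys
  ys! = AllPairs-++⁻ˡ ys (AllPairs-resp-↭ (≡.setoid _) (_∘ ≡.sym) (≡.resp₂ _≢_) (↭⇒↭ₛ σ) (allFin⁺ n))

-- Clique tests by evaluation, and two Ramsey graphs.

-- A Boolean test, so that for a concrete graph `tt` is the whole proof. The value at `zero` is
-- `false` because the empty clique always exists.
cliqueFree : ∀ {n} → Graph n → ℕ → List (Fin n) → Bool
cliqueFree G zero    C = false
cliqueFree G (suc p) C = all (λ v → cliqueFree G p (filterᵇ (adj G v) C)) C

cliqueFree-sound : ∀ {n} (G : Graph n) p C → T (cliqueFree G p C) →
                   ∀ f → IsClique G p f → ¬ (∀ i → f i ∈ C)
cliqueFree-sound G (suc p) C free f clique f∈ =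
  cliqueFree-sound G p (filterᵇ (adj G (f zero)) C) (All.lookup (all⁺ _ C free) (f∈ zero)) (f ∘ suc)
    (λ i j i≢j → clique (suc i) (suc j) (i≢j ∘ suc-injective))
    (λ i → ∈-filter⁺ (λ y → T? (adj G (f zero) y)) (f∈ (suc i))
             (subst T (≡.sym (clique zero (suc i) λ ())) tt))

cliqueFree⇒CliqueNumberBelow : ∀ {n} (G : Graph n) p → T (cliqueFree G p (allFin n)) →
                               CliqueNumberBelow G p
cliqueFree⇒CliqueNumberBelow {n} G p free (f , clique) =
  cliqueFree-sound G p (allFin n) free f clique (∈-allFin ∘ f)

-- Distances are taken between integers: a circulant graph modulo p needs both d and p - d in `ds`,
-- and a smaller `n` deletes its last vertices.
distanceGraph : ∀ n (ds : List ℕ) → any (0 ≡ᵇ_) ds ≡ false → Graph n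
distanceGraph n ds 0∉ .adj x y       = any (∣ toℕ x - toℕ y ∣ ≡ᵇ_) ds
distanceGraph n ds 0∉ .Graph.sym x y = cong (λ d → any (d ≡ᵇ_) ds) (∣-∣-comm (toℕ x) (toℕ y))
distanceGraph n ds 0∉ .loopless x    = ≡.trans (cong (λ d → any (d ≡ᵇ_) ds) (∣n-n∣≡0 (toℕ x))) 0∉

-- The complement of the cubic residue graph modulo 13, which shows R(3,5) > 13.
G₁₃ : Graph 13
G₁₃ = distanceGraph 13 (2 ∷ 3 ∷ 4 ∷ 6 ∷ 7 ∷ 9 ∷ 10 ∷ 11 ∷ []) refl

-- Six independent sets cover at most `6 * 2 = 12` of the 13 vertices.
G₁₃∈Hv : InHv G₁₃ 6 5
G₁₃∈Hv = pigeonhole⇒VArrows G₁₃ 2 6 (cliqueFree⇒CliqueNumberBelow (complement G₁₃) 3 tt) ≤-refl ,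
         cliqueFree⇒CliqueNumberBelow G₁₃ 5 tt

-- The Paley graph of order 17, which shows R(4,4) > 17, without one vertex.
G₁₆ : Graph 16
G₁₆ = distanceGraph 16 (1 ∷ 2 ∷ 4 ∷ 8 ∷ 9 ∷ 13 ∷ 15 ∷ []) refl

-- Five independent sets cover at most `5 * 3 = 15` vertices, so 16 suffice and one of the 17 can be
-- spared.
G₁₆∈Hv : InHv G₁₆ 5 4
G₁₆∈Hv = pigeonhole⇒VArrows G₁₆ 3 5 (cliqueFree⇒CliqueNumberBelow (complement G₁₆) 4 tt) ≤-refl ,
         cliqueFree⇒CliqueNumberBelow G₁₆ 4 tt

-- Cones, and the bounds for all `r`.

cone : ∀ {n} → Graph n → Graph (suc n)
cone G .adj zero    zero    = false
cone G .adj zero    (suc y) = true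
cone G .adj (suc x) zero    = true
cone G .adj (suc x) (suc y) = adj G x y
cone G .Graph.sym zero    zero    = refl
cone G .Graph.sym zero    (suc y) = refl
cone G .Graph.sym (suc x) zero    = refl
cone G .Graph.sym (suc x) (suc y) = Graph.sym G x y
cone G .loopless zero    = refl
cone G .loopless (suc x) = loopless G x

cone-VArrows : ∀ {n} (G : Graph n) r → VArrows G r (twos r) →
               VArrows (cone G) (suc r) (twos (suc r))
cone-VArrows G r arr c with any? (λ y → c (suc y) ≟ᶠ c zero)
... | yes (y , eq) = c zero , lookup (zero ∷ suc y ∷ []) ,
      listClique (cone G) ((refl ∷ []) ∷ [] ∷ []) ,
      λ k → All.lookup {P = λ v → c v ≡ c zero} (refl ∷ eq ∷ []) (∈-lookup k)
-- The colour of the apex does not occur on `G`; removing it leaves a colouring with `r` colours.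
... | no ∄ with arr (λ y → punchOut {i = c zero} {c (suc y)} λ eq → ∄ (y , ≡.sym eq))
...   | i , f , clique , mono = punchIn (c zero) i , suc ∘ f , clique ,
        λ k → ≡.trans (≡.sym (punchIn-punchOut _)) (cong (punchIn (c zero)) (mono k))

cone-removeApex : ∀ {n q} (G : Graph n) (f : Fin q → Fin (suc n)) → IsClique (cone G) q f →
                  (∀ i → zero ≢ f i) → HasClique G q
cone-removeApex G f clique 0≢f = (λ i → punchOut (0≢f i)) , λ i j i≢j →
  ≡.subst₂ (Adj (cone G)) (≡.sym (punchIn-punchOut (0≢f i))) (≡.sym (punchIn-punchOut (0≢f j)))
    (clique i j i≢j)

cone-HasClique : ∀ {n} (G : Graph n) q → HasClique (cone G) (suc q) → HasClique G q
cone-HasClique G q (f , clique) with any? (λ i → f i ≟ᶠ zero)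
-- A clique that avoids the apex may lose any vertex; the first is dropped.
... | no ∄ = cone-removeApex G (f ∘ suc) (λ i j i≢j → clique _ _ (i≢j ∘ suc-injective))
               λ i 0≡fi → ∄ (suc i , ≡.sym 0≡fi)
... | yes (i , fi≡0) = cone-removeApex G (f ∘ punchIn i)
        (λ j k j≢k → clique _ _ (j≢k ∘ punchIn-injective i j k))
        -- A second occurrence of the apex would make it adjacent to itself.
        λ j 0≡fj → case ≡.subst₂ (Adj (cone G)) fi≡0 (≡.sym 0≡fj)
                          (clique i (punchIn i j) (punchInᵢ≢i i j ∘ ≡.sym)) of λ ()

-- A cone raises the order, the number of colours and the clique bound by one each, so the order
-- stays 7 above the number of colours, as in `13 = 6 + 7`.
iteratedCone : ∀ t → ∃ λ (G : Graph (t + 13)) → InHv G (t + 6) (t + 5)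
iteratedCone zero    = G₁₃ , G₁₃∈Hv
iteratedCone (suc t) with iteratedCone t
... | G , arr , ¬clique = cone G , cone-VArrows G (t + 6) arr , ¬clique ∘ cone-HasClique G (t + 5)

theorem1p5 : (r : ℕ) → 4 ≤ r →
    ((m : ℕ) → IsFv r (r ∸ 1) m → r + 7 ≤ m) ×
    (6 ≤ r → IsFv r (r ∸ 1) (r + 7)) ×
    ((m : ℕ) → IsFv 5 4 m → m ≤ 16)
theorem1p5 (suc (suc k)) (s≤s (s≤s _)) =
  (λ m ((G , G∈Hv) , _) → ≮⇒≥ λ m< → lower m m< G G∈Hv) ,
  (λ 6≤r → upper (≤-pred (≤-pred 6≤r)) , lower) ,
  λ m (_ , minimal) → ≮⇒≥ λ 16<m → minimal 16 16<m G₁₆ G₁₆∈Hv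
  where
  lower : ∀ n → n < 2 + k + 7 → (G : Graph n) → ¬ InHv G (2 + k) (1 + k)
  lower n n< G = ¬InHv k G (subst (n <_) (lem k) n<)
    where
    lem : ∀ k → 2 + k + 7 ≡ k + 9
    lem = solve-∀
  upper : 4 ≤ k → ∃ λ (G : Graph (2 + k + 7)) → InHv G (2 + k) (1 + k)
  -- Since `r = 6 + t`, exactly `t` cones over `G₁₃` are required.
  upper 4≤k with k ∸ 4 | m+[n∸m]≡n 4≤k
  ... | t | refl with iteratedCone t
  ...   | cones rewrite +-comm t 6 | +-comm t 5 =
          subst (λ m → ∃ λ (G : Graph m) → InHv G (6 + t) (5 + t)) (lem t) cones
    where
    lem : ∀ t → t + 13 ≡ 6 + t + 7
    lem = solve-∀
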